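{- Let $\mathbf{a}=\langle a_1,\dots,a_s\rangle$ and $\mathbf{b}=\langle b_1,\dots,b_t\rangle$ be integer vectors with $a_1+\cdots+a_s=b_1+\cdots+b_t$, and let $n,m$ be positive integers. Let $r+1=\max(s,n+t)$ and \[\delta=a_1\varepsilon_1+\cdots+a_s\varepsilon_s-(b_1\varepsilon_{n+1}+\cdots+b_t\varepsilon_{n+t})\in\mathbb{Z}^{r+1}.\] Let $\Lambda=\{\varepsilon_i-\varepsilon_j:1\le i<j\le r+1,\ i\le n\}\subseteq\Phi^+_{A_r}$ and \[Q_\Lambda(\delta)=\Big\{p\in P_\Lambda(\delta):\ a_j+\#\{\text{elements of }p\text{ of the form }\varepsilon_i-\varepsilon_j\}\le m\ \text{for all } j\ge1\Big\},\] where $a_j=0$ for $j>s$ and elements of $p$ are counted with multiplicity. Then the map sending a juggling sequence to the multiset of roots $\varepsilon_i-\varepsilon_{i+j}$ (one per throw at time $i$ to height $j$) is a bijection from $\mathrm{JS}(\mathbf{a},\mathbf{b},n,m)$ onto $Q_\Lambda(\delta)$; hence $\mathsf{js}(\mathbf{a},\mathbf{b},n,m)=|Q_\Lambda(\delta)|$. Moreover, without hand capacity constraint, $\mathsf{js}(\mathbf{a},\mathbf{b},n)=K_\Lambda(\delta)$.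
   Context: A juggling state is a finitely supported integer vector $\mathbf{s}=\langle s_1,s_2,\dots\rangle$ indexed by heights (trailing zeros omitted; negative entries are magic balls). A juggling sequence of length $n$ from $\mathbf{a}$ to $\mathbf{b}$ is a sequence $(\mathbf{s}_0,\dots,\mathbf{s}_n)$ with $\mathbf{s}_0=\mathbf{a}$, $\mathbf{s}_n=\mathbf{b}$, such that for each $1\le i\le n$ there are nonnegative integers $c^{(i)}_k$ (finitely many nonzero) with $\sum_k c^{(i)}_k=(\mathbf{s}_{i-1})_1$ and $(\mathbf{s}_i)_k=(\mathbf{s}_{i-1})_{k+1}+c^{(i)}_k$ for all $k\ge1$; $c^{(i)}_j$ is the number of throws at time $i$ to height $j$. It has hand capacity $m$ if all entries of all $\mathbf{s}_i$ are $\le m$. $\mathrm{JS}(\mathbf{a},\mathbf{b},n,m)$ is the set of such sequences with hand capacity $m$, $\mathsf{js}(\mathbf{a},\mathbf{b},n,m)$ its cardinality; $\mathrm{JS}(\mathbf{a},\mathbf{b},n)$, $\mathsf{js}(\mathbf{a},\mathbf{b},n)$ are the same without hand capacity constraint. $\Phi^+_{A_r}=\{\varepsilon_i-\varepsilon_j:1\le i<j\le r+1\}\subset\mathbb{R}^{r+1}$; for $\Lambda\subseteq\Phi^+_{A_r}$, $P_\Lambda(\mu)$ is the set of finite multisets of elements of $\Lambda$ summing to $\mu$, and $K_\Lambda(\mu)=|P_\Lambda(\mu)|$. -}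

-- All indices are shifted to start at 0: entry k of a state is the entry at
-- height k + 1, ε i is the basis vector ε_{i+1}, and τ : Fin n is time τ + 1.
module Defs where

open import Data.Bool.Base using (if_then_else_)
open import Data.Fin.Base using (Fin; Fin′; zero; suc; toℕ; inject₁; fromℕ)
open import Data.Integer.Base using (ℤ; 0ℤ; 1ℤ; +_; _+_; _-_; _*_; _≤_)
import Data.Integer.Base as ℤ
open import Data.Nat.Base as ℕ using (ℕ; zero; suc)
import Data.Nat.Properties as ℕ using (_≟_)
open import Data.Product.Base using (Σ; _×_; _,_; proj₁)
open import Data.Vec.Functional using (Vector; head; tail)
open import Function.Base using (_∘_)
open import Function.Bundles using (Bijection)
open import Level using (0ℓ)
open import Relation.Binary.Bundles using (Setoid)
import Relation.Binary.Construct.On as On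
open import Relation.Binary.PropositionalEquality
  using (_≡_; _≢_; refl; sym; trans; setoid; _→-setoid_)
open import Relation.Nullary.Decidable.Core using (does; _×-dec_)
open import Relation.Unary using (Pred; Decidable)

open import Algebra.Definitions.RawMonoid ℤ.+-0-rawMonoid public
  using () renaming (sum to sumℤ)
open import Algebra.Definitions.RawMonoid ℕ.+-0-rawMonoid public
  using () renaming (sum to sumℕ)

-- The set represented by a setoid has exactly N elements (so it is finite).
HasCardinality : Setoid 0ℓ 0ℓ → ℕ → Set
HasCardinality S N = Bijection S (setoid (Fin N))

------------------------------------------------------------------------
-- Juggling sequences

record FinitelySupported {A : Set} (0# : A) (f : ℕ → A) : Set where
  field
    bound    : ℕ
    vanishes : ∀ k → bound ℕ.≤ k → f k ≡ 0#

record State : Set where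
  field
    entry  : ℕ → ℤ
    finite : FinitelySupported 0ℤ entry

open State public using (entry)

padded : ∀ {s} → Vector ℤ s → ℕ → ℤ
padded {zero}  a k       = 0ℤ
padded {suc s} a zero    = head a
padded {suc s} a (suc k) = padded (tail a) k

padded-vanishes : ∀ {s} (a : Vector ℤ s) k → s ℕ.≤ k → padded a k ≡ 0ℤ
padded-vanishes {zero}  a k       _           = refl
padded-vanishes {suc s} a (suc k) (ℕ.s≤s s≤k) = padded-vanishes (tail a) k s≤k

⟨_⟩ : ∀ {s} → Vector ℤ s → State
⟨_⟩ {s} a = record
  { entry  = padded a
  ; finite = record { bound = s ; vanishes = padded-vanishes a }
  }

-- The counts are determined by s and s′ through `next`, so no two distinct
-- steps join the same states.
record Step (s s′ : State) : Set where
  field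
    throws : ℕ → ℕ
    finite : FinitelySupported 0 throws

  open FinitelySupported finite

  field
    total : + sumℕ {bound} (throws ∘ toℕ) ≡ entry s 0
    next  : ∀ k → entry s′ k ≡ entry s (suc k) + + throws k

record JugglingSequence (a b : State) (n : ℕ) : Set where
  field
    state : Fin (suc n) → State
    start : ∀ k → entry (state zero) k ≡ entry a k
    end   : ∀ k → entry (state (fromℕ n)) k ≡ entry b k
    step  : (τ : Fin n) → Step (state (inject₁ τ)) (state (suc τ))

  throws : Fin n → ℕ → ℕ
  throws τ = Step.throws (step τ)

HandCapacity : ∀ {a b n} → ℕ → Pred (JugglingSequence a b n) 0ℓ
HandCapacity m S = ∀ i k → entry (JugglingSequence.state S i) k ≤ + m

-- Two juggling sequences are equal when their states have the same entries.
JS : State → State → ℕ → Setoid 0ℓ 0ℓ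
JS a b n = record
  { Carrier       = JugglingSequence a b n
  ; _≈_           = λ S T → ∀ i k → entry (state S i) k ≡ entry (state T i) k
  ; isEquivalence = record
    { refl  = λ i k → refl
    ; sym   = λ p i k → sym (p i k)
    ; trans = λ p q i k → trans (p i k) (q i k)
    }
  }
  where open JugglingSequence

JSₘ : State → State → ℕ → ℕ → Setoid 0ℓ 0ℓ
JSₘ a b n m = record
  { Carrier       = Σ (JugglingSequence a b n) (HandCapacity m)
  ; isEquivalence = On.isEquivalence proj₁ (Setoid.isEquivalence (JS a b n))
  }

------------------------------------------------------------------------
-- Positive roots of type A_r

-- The zero vector for i > r.
ε : ∀ {r} → ℕ → Vector ℤ (suc r)
ε i x = if does (toℕ x ℕ.≟ i) then 1ℤ else 0ℤ

-- The root ε_i - ε_j with i < j, as Fin′ j is the type of indices below j.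
-- Distinct pairs give distinct vectors.
record Root (r : ℕ) : Set where
  constructor root
  field
    j : Fin (suc r)
    i : Fin′ j

src tgt : ∀ {r} → Root r → ℕ
src α = toℕ (Root.i α)
tgt α = toℕ (Root.j α)

⟦_⟧ : ∀ {r} → Root r → Vector ℤ (suc r)
⟦ α ⟧ x = ε (src α) x - ε (tgt α) x

-- As there are finitely many roots, any multiplicity function is that of a
-- finite multiset.
Multiset : ℕ → Set
Multiset r = Root r → ℕ

total : ∀ {r} → Multiset r → Vector ℤ (suc r)
total p x = sumℤ λ j → sumℤ λ i → + p (root j i) * ⟦ root j i ⟧ x

-- Number of elements of p satisfying the predicate, with multiplicity.
# : ∀ {r} {P : Pred (Root r) 0ℓ} → Decidable P → Multiset r → ℕ
# P? p = sumℕ λ j → sumℕ λ i →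
  if does (P? (root j i)) then p (root j i) else 0

multiplicity : ∀ {r} → (i j : ℕ) → Multiset r → ℕ
multiplicity i j = # λ α → (src α ℕ.≟ i) ×-dec (tgt α ℕ.≟ j)

landing : ∀ {r} → (j : ℕ) → Multiset r → ℕ
landing j = # λ α → tgt α ℕ.≟ j

------------------------------------------------------------------------
-- Vector partitions

record IsPartition {r} (Λ : Pred (Root r) 0ℓ) (μ : Vector ℤ (suc r))
                   (p : Multiset r) : Set where
  field
    support : ∀ α → p α ≢ 0 → Λ α
    sums    : ∀ x → total p x ≡ μ x

P : ∀ {r} → Pred (Root r) 0ℓ → Vector ℤ (suc r) → Setoid 0ℓ 0ℓ
P {r} Λ μ = record
  { Carrier       = Σ (Multiset r) (IsPartition Λ μ)
  ; isEquivalence = On.isEquivalence proj₁ (Setoid.isEquivalence (Root r →-setoid ℕ))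
  }

Q : ∀ {r s} → Pred (Root r) 0ℓ → Vector ℤ (suc r) → Vector ℤ s → ℕ → Setoid 0ℓ 0ℓ
Q {r} Λ μ a m = record
  { Carrier       = Σ (Setoid.Carrier (P Λ μ)) λ (p , _) →
                      ∀ j → padded a j + + landing j p ≤ + m
  ; isEquivalence = On.isEquivalence proj₁ (Setoid.isEquivalence (P Λ μ))
  }

Λ[_] : ∀ {r} → ℕ → Pred (Root r) 0ℓ
Λ[ n ] α = src α ℕ.< n

δ : ∀ {r s t} → Vector ℤ s → Vector ℤ t → ℕ → Vector ℤ (suc r)
δ a b n x = sumℤ (λ i → a i * ε (toℕ i) x)
          - sumℤ (λ j → b j * ε (n ℕ.+ toℕ j) x)

-- p consists of one root ε_τ - ε_{τ+h} for each throw of S at time τ to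
-- height h = k + 1. If such an index exceeds the dimension, `multiplicity`
-- is 0, so that there must be no such throw.
IsRootsOfThrows : ∀ {r a b n} → JugglingSequence a b n → Pred (Multiset r) 0ℓ
IsRootsOfThrows {r} {n = n} S p =
  (∀ α → p α ≢ 0 → Λ[ n ] α) ×
  (∀ (τ : Fin n) k →
    multiplicity (toℕ τ) (toℕ τ ℕ.+ suc k) p ≡ JugglingSequence.throws S τ k)

{-# OPTIONS --safe #-}
-- Encode both objects by the matrix c, where c i j is the number of throws at
-- time i that land at time j, i.e. the multiplicity of ε_i - ε_j. By induction
-- on i, the entry at position k after i steps is a_{i+k} + Σ_{τ<i} c τ (i+k).
-- Hence the throw-count condition at time i says that row i of c sums to a_i
-- plus column i, and the final state is b exactly when a_x plus column x is
-- b_{x-n} for x ≥ n: together these are the coordinates of "the roots sum to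
-- δ". A position x is fullest at time min(n,x), when its entry is a_x plus
-- column x, so that hand capacity becomes the bound on landings. The sets are
-- finite because row x is bounded in terms of δ_x and the rows before it.
module Submission where

open import Defs
open import Data.Nat using (ℕ; suc; _+_; _⊔_; NonZero)
open import Data.Integer using (ℤ)
open import Data.Product using (Σ-syntax; ∃-syntax; _×_; proj₁)
open import Data.Vec.Functional using (Vector)
open import Function.Bundles using (Bijection)
open import Relation.Binary.PropositionalEquality using (_≡_)

open import Data.Bool.Base using (if_then_else_; true; false; _∧_)
open import Data.Bool.Properties using (∧-identityʳ; ∧-zeroʳ)
open import Data.Fin.Base using (Fin; zero; suc; toℕ; inject₁; fromℕ; fromℕ<)
open import Data.Fin.Induction using (<-weakInduction)
import Data.Fin.Properties as Fin
open import Data.Integer.Base as ℤ using (+_; 0ℤ; 1ℤ)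
import Data.Integer.Properties as ℤ
open import Data.Integer.Solver using (module +-*-Solver)
open import Data.List.Base
  using (List; _∷_; [_]; map; cartesianProductWith; upTo; filter; deduplicate; length; lookup)
open import Data.List.Membership.Propositional.Properties using (∈-upTo⁺) renaming (∈-lookup to lookup-∈)
import Data.List.Membership.Setoid as Membership
open import Data.List.Membership.Setoid.Properties
  using (∈-filter⁺; ∈-deduplicate⁺; ∈-lookup; index-injective)
open import Data.List.Relation.Unary.All as All using ()
import Data.List.Relation.Unary.All.Properties as All
open import Data.List.Relation.Unary.AllPairs using (_∷_)
open import Data.List.Relation.Unary.Any as Any using (Any; here; there; index)
import Data.List.Relation.Unary.Any.Properties as Any
open import Data.List.Relation.Unary.Unique.DecSetoid.Properties using (deduplicate-!)
import Data.List.Relation.Unary.Unique.Setoid as Unique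
open import Data.Nat.Base using (zero; _≤_; _<_; z≤n; s≤s; _≡ᵇ_)
import Data.Nat.Properties as ℕ
open import Data.Product.Base using (Σ; _,_; proj₂)
open import Data.Sum.Base using (_⊎_; inj₁; inj₂)
open import Function.Base using (_∘_)
import Function.Construct.Composition as Composition
open import Level using (0ℓ)
open import Relation.Binary.Bundles using (DecSetoid; Setoid)
import Relation.Binary.Construct.On as On
open import Relation.Binary.Definitions using (_Respects_)
open import Relation.Binary.PropositionalEquality
  using (_≢_; _≗_; refl; sym; trans; cong; cong₂; subst; _→-setoid_; module ≡-Reasoning)
open import Relation.Nullary.Decidable
  using (Dec; yes; no; map′; ¬?; _×-dec_; _→-dec_)
open import Relation.Nullary.Negation using (contradiction)
open import Relation.Unary using (Decidable; Pred)

open import Algebra.Properties.CommutativeMonoid.Sum ℤ.+-0-commutativeMonoid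
  using () renaming (sum-cong-≗ to sumℤ-cong; ∑-distrib-+ to sumℤ-+)
open import Algebra.Properties.CommutativeMonoid.Sum ℕ.+-0-commutativeMonoid
  using () renaming (sum-cong-≗ to sumℕ-cong)
open import Algebra.Properties.Semiring.Sum ℤ.+-*-semiring
  using () renaming (*-distribʳ-sum to sumℤ-*ʳ)
open import Algebra.Properties.AbelianGroup ℤ.+-0-abelianGroup
  using () renaming (∙-cancelˡ to ℤ-cancelˡ)

private variable
  r s t n : ℕ
  A : Set

-- Functions on an initial segment of ℕ

view-< : ∀ n i → (Σ[ x ∈ Fin n ] toℕ x ≡ i) ⊎ n ≤ i
view-< n i with ℕ.<-≤-connex i n
... | inj₁ i<n = inj₁ (fromℕ< i<n , Fin.toℕ-fromℕ< i<n)
... | inj₂ n≤i = inj₂ n≤i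

view-≤ : ∀ m n → (∃[ k ] m + k ≡ n) ⊎ n < m
view-≤ m n with ℕ.≤-<-connex m n
... | inj₁ m≤n = inj₁ (ℕ.m≤n⇒∃[o]m+o≡n m≤n)
... | inj₂ n<m = inj₂ n<m

extend : Vector ℕ n → ℕ → ℕ
extend {zero}  f k       = 0
extend {suc n} f zero    = f zero
extend {suc n} f (suc k) = extend (f ∘ suc) k

extend-toℕ : (f : Vector ℕ n) (x : Fin n) → extend f (toℕ x) ≡ f x
extend-toℕ f zero    = refl
extend-toℕ f (suc x) = extend-toℕ (f ∘ suc) x

extend-vanishes : (f : Vector ℕ n) → ∀ {k} → n ≤ k → extend f k ≡ 0
extend-vanishes f z≤n       = refl
extend-vanishes f (s≤s n≤k) = extend-vanishes (f ∘ suc) n≤k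

extend-zero : (f : Vector ℕ n) → (∀ x → f x ≡ 0) → ∀ k → extend f k ≡ 0
extend-zero {zero}  f f≡0 k       = refl
extend-zero {suc n} f f≡0 zero    = f≡0 zero
extend-zero {suc n} f f≡0 (suc k) = extend-zero (f ∘ suc) (f≡0 ∘ suc) k

extend-cong : {f g : Vector ℕ n} → f ≗ g → extend f ≗ extend g
extend-cong {zero}  f≗g k       = refl
extend-cong {suc n} f≗g zero    = f≗g zero
extend-cong {suc n} f≗g (suc k) = extend-cong (f≗g ∘ suc) k

padded-+ : (f : Vector ℕ n) → padded (+_ ∘ f) ≗ +_ ∘ extend f
padded-+ {zero}  f k       = refl
padded-+ {suc n} f zero    = refl
padded-+ {suc n} f (suc k) = padded-+ (f ∘ suc) k

-- Serves two purposes: it turns throws indexed by height into throws indexed by landing time, and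
-- it places the entries of `b` at the coordinates from `n` on.
shift : A → ℕ → (ℕ → A) → ℕ → A
shift 0# zero    f k       = f k
shift 0# (suc m) f zero    = 0#
shift 0# (suc m) f (suc k) = shift 0# m f k

shift-+ : (0# : A) → ∀ m f k → shift 0# m f (m + k) ≡ f k
shift-+ 0# zero    f k = refl
shift-+ 0# (suc m) f k = shift-+ 0# m f k

shift-vanishes : (0# : A) → ∀ {m} f {k} → k < m → shift 0# m f k ≡ 0#
shift-vanishes 0# f {zero}  (s≤s _)   = refl
shift-vanishes 0# f {suc k} (s≤s k<m) = shift-vanishes 0# f k<m

shift-cong : (0# : A) → ∀ m {f g} → f ≗ g → shift 0# m f ≗ shift 0# m g
shift-cong 0# zero    f≗g k       = f≗g k
shift-cong 0# (suc m) f≗g zero    = refl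
shift-cong 0# (suc m) f≗g (suc k) = shift-cong 0# m f≗g k

-- Finite sums

sumTo : ℕ → (ℕ → ℕ) → ℕ
sumTo n f = sumℕ {n} (f ∘ toℕ)

sumTo-cong : ∀ n {f g} → (∀ {k} → k < n → f k ≡ g k) → sumTo n f ≡ sumTo n g
sumTo-cong zero    f≡g = refl
sumTo-cong (suc n) f≡g = cong₂ _+_ (f≡g (s≤s z≤n)) (sumTo-cong n (f≡g ∘ s≤s))

sumTo-zero : ∀ n {f} → (∀ k → f k ≡ 0) → sumTo n f ≡ 0
sumTo-zero zero    f≡0 = refl
sumTo-zero (suc n) f≡0 = cong₂ _+_ (f≡0 0) (sumTo-zero n (f≡0 ∘ suc))

sumTo-last : ∀ n f → sumTo (suc n) f ≡ sumTo n f + f n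
sumTo-last zero    f = ℕ.+-comm (f 0) 0
sumTo-last (suc n) f = begin
  f 0 + sumTo (suc n) (f ∘ suc)         ≡⟨ cong (_+_ (f 0)) (sumTo-last n (f ∘ suc)) ⟩
  f 0 + (sumTo n (f ∘ suc) + f (suc n)) ≡⟨ ℕ.+-assoc (f 0) _ _ ⟨
  sumTo (suc n) f + f (suc n)           ∎
  where open ≡-Reasoning

-- A finitely supported function comes with some bound of its own, and each side of the
-- correspondence chooses a different one. Common terms are stripped until one bound is 0, and then
-- the whole remaining function vanishes.
sumTo-agree : ∀ m n f → (∀ k → m ≤ k → f k ≡ 0) → (∀ k → n ≤ k → f k ≡ 0) →
              sumTo m f ≡ sumTo n f
sumTo-agree zero    n       f p q = sym (sumTo-zero n λ k → p k z≤n)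
sumTo-agree (suc m) zero    f p q = sumTo-zero (suc m) λ k → q k z≤n
sumTo-agree (suc m) (suc n) f p q =
  cong (_+_ (f 0)) (sumTo-agree m n (f ∘ suc) (λ k → p (suc k) ∘ s≤s) (λ k → q (suc k) ∘ s≤s))

sumTo-drop : ∀ m n f → (∀ k → k < m → f k ≡ 0) → sumTo (m + n) f ≡ sumTo n (f ∘ (_+_ m))
sumTo-drop zero    n f p = refl
sumTo-drop (suc m) n f p =
  cong₂ _+_ (p 0 (s≤s z≤n)) (sumTo-drop m n (f ∘ suc) (λ k → p (suc k) ∘ s≤s))

sumTo-monoˡ : ∀ {m n} f → m ≤ n → sumTo m f ≤ sumTo n f
sumTo-monoˡ f z≤n       = z≤n
sumTo-monoˡ f (s≤s m≤n) = ℕ.+-monoʳ-≤ (f 0) (sumTo-monoˡ (f ∘ suc) m≤n)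

sumTo-monoʳ : ∀ n {f g} → (∀ k → f k ≤ g k) → sumTo n f ≤ sumTo n g
sumTo-monoʳ zero    f≤g = z≤n
sumTo-monoʳ (suc n) f≤g = ℕ.+-mono-≤ (f≤g 0) (sumTo-monoʳ n (f≤g ∘ suc))

term≤sumTo : ∀ {n} f {k} → k < n → f k ≤ sumTo n f
term≤sumTo {n} f {k} k<n = begin
  f k           ≤⟨ ℕ.m≤n+m (f k) (sumTo k f) ⟩
  sumTo k f + f k ≡⟨ sumTo-last k f ⟨
  sumTo (suc k) f ≤⟨ sumTo-monoˡ f k<n ⟩
  sumTo n f     ∎
  where open ℕ.≤-Reasoning

sumℕ-zero : (f : Vector ℕ n) → (∀ x → f x ≡ 0) → sumℕ f ≡ 0
sumℕ-zero {zero}  f f≡0 = refl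
sumℕ-zero {suc n} f f≡0 = cong₂ _+_ (f≡0 zero) (sumℕ-zero (f ∘ suc) (f≡0 ∘ suc))

-- Stated with `≡ᵇ` because `does` of the decision `_≟_` on ℕ computes to it; the unfolded `#` then
-- matches definitionally. The index `k` may be out of range, hence `extend`.
sumℕ-indicator : (f : Vector ℕ n) → ∀ k →
                 sumℕ (λ x → if toℕ x ≡ᵇ k then f x else 0) ≡ extend f k
sumℕ-indicator {zero}  f k       = refl
sumℕ-indicator {suc n} f zero    =
  trans (cong (_+_ (f zero)) (sumℕ-zero {n} _ λ _ → refl)) (ℕ.+-identityʳ (f zero))
sumℕ-indicator {suc n} f (suc k) = sumℕ-indicator (f ∘ suc) k

sumℤ-zero : (f : Vector ℤ n) → (∀ x → f x ≡ 0ℤ) → sumℤ f ≡ 0ℤ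
sumℤ-zero {zero}  f f≡0 = refl
sumℤ-zero {suc n} f f≡0 = cong₂ ℤ._+_ (f≡0 zero) (sumℤ-zero (f ∘ suc) (f≡0 ∘ suc))

sumℤ-neg : (f : Vector ℤ n) → sumℤ (ℤ.-_ ∘ f) ≡ ℤ.- sumℤ f
sumℤ-neg {zero}  f = refl
sumℤ-neg {suc n} f =
  trans (cong (ℤ._+_ (ℤ.- f zero)) (sumℤ-neg (f ∘ suc))) (sym (ℤ.neg-distrib-+ (f zero) _))

sumℤ-minus : (f g : Vector ℤ n) → sumℤ (λ x → f x ℤ.- g x) ≡ sumℤ f ℤ.- sumℤ g
sumℤ-minus f g = trans (sumℤ-+ f (ℤ.-_ ∘ g)) (cong (ℤ._+_ (sumℤ f)) (sumℤ-neg g))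

sumℤ-pos : (f : Vector ℕ n) → sumℤ (+_ ∘ f) ≡ + sumℕ f
sumℤ-pos {zero}  f = refl
sumℤ-pos {suc n} f =
  trans (cong (ℤ._+_ (+ f zero)) (sumℤ-pos (f ∘ suc))) (sym (ℤ.pos-+ (f zero) _))

-- `ε i x` unfolds to `indicator i (toℕ x)`. With the coordinate a natural number, recursion on it
-- is available.
indicator : ℕ → ℕ → ℤ
indicator i k = if k ≡ᵇ i then 1ℤ else 0ℤ

sumℤ-indicator : (f : Vector ℤ n) → ∀ k →
                 sumℤ (λ x → f x ℤ.* indicator (toℕ x) k) ≡ padded f k
sumℤ-indicator {zero}  f k       = refl
sumℤ-indicator {suc n} f zero    = begin
  f zero ℤ.* 1ℤ ℤ.+ sumℤ (λ x → f (suc x) ℤ.* 0ℤ)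
    ≡⟨ cong₂ ℤ._+_ (ℤ.*-identityʳ (f zero)) (sumℤ-zero {n} _ λ x → ℤ.*-zeroʳ (f (suc x))) ⟩
  f zero ℤ.+ 0ℤ  ≡⟨ ℤ.+-identityʳ (f zero) ⟩
  f zero ∎
  where open ≡-Reasoning
sumℤ-indicator {suc n} f (suc k) =
  trans (cong₂ ℤ._+_ (ℤ.*-zeroʳ (f zero)) refl)
        (trans (ℤ.+-identityˡ _) (sumℤ-indicator (f ∘ suc) k))

sumℤ-indicator-shift : (f : Vector ℤ n) → ∀ m k →
  sumℤ (λ x → f x ℤ.* indicator (m + toℕ x) k) ≡ shift 0ℤ m (padded f) k
sumℤ-indicator-shift f zero    k       = sumℤ-indicator f k
sumℤ-indicator-shift f (suc m) zero    = sumℤ-zero _ λ x → ℤ.*-zeroʳ (f x)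
sumℤ-indicator-shift f (suc m) (suc k) = sumℤ-indicator-shift f m k

-- Multisets of roots as matrices

-- Filled with zeros on all pairs of naturals, so that multisets and juggling sequences have
-- matrices of one type, whose indices carry no bounds.
coefficient : Multiset r → ℕ → ℕ → ℕ
coefficient p i j = extend (λ y → extend (λ x → p (root y x)) i) j

outflow : ℕ → (ℕ → ℕ → ℕ) → ℕ → ℕ
outflow r c x = sumTo (suc r) (c x)

-- In a strictly upper triangular matrix column `x` is zero from row `x` on, so the sum may stop
-- there and does not depend on the dimension.
inflow : (ℕ → ℕ → ℕ) → ℕ → ℕ
inflow c x = sumTo x (λ i → c i x)

rootsOf : (ℕ → ℕ → ℕ) → Multiset r
rootsOf c α = c (src α) (tgt α)

record StrictlyUpper (r : ℕ) (c : ℕ → ℕ → ℕ) : Set where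
  field
    triangular : ∀ {i j} → j ≤ i → c i j ≡ 0
    bounded    : ∀ i {j} → r < j → c i j ≡ 0

coefficient-root : (p : Multiset r) (α : Root r) → coefficient p (src α) (tgt α) ≡ p α
coefficient-root p (root j i) =
  trans (extend-toℕ (λ y → extend (λ x → p (root y x)) (toℕ i)) j)
        (extend-toℕ (λ x → p (root j x)) i)

coefficient-strictlyUpper : (p : Multiset r) → StrictlyUpper r (coefficient p)
coefficient-strictlyUpper {r} p = record
  { triangular = λ {i} {j} → triangular i j
  ; bounded    = λ i → extend-vanishes (λ y → extend (λ x → p (root y x)) i)
  }
  where
  triangular : ∀ i j → j ≤ i → coefficient p i j ≡ 0
  triangular i j j≤i with view-< (suc r) j
  ... | inj₁ (y , refl) = trans (extend-toℕ (λ y → extend (λ x → p (root y x)) i) y)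
                                (extend-vanishes (λ x → p (root y x)) j≤i)
  ... | inj₂ r<j        = extend-vanishes (λ y → extend (λ x → p (root y x)) i) r<j

coefficient-cong : {p q : Multiset r} → p ≗ q → ∀ i j → coefficient p i j ≡ coefficient q i j
coefficient-cong p≗q i = extend-cong λ y → extend-cong (λ x → p≗q (root y x)) i

coefficient-unsupported : (p : Multiset r) → (∀ α → p α ≢ 0 → Λ[ n ] α) →
                          ∀ {i} → n ≤ i → ∀ j → coefficient p i j ≡ 0
coefficient-unsupported {r} {n} p supp {i} n≤i = extend-zero _ column
  where
  column : ∀ y → extend (λ x → p (root y x)) i ≡ 0
  column y with view-< (toℕ y) i
  ... | inj₂ y≤i = extend-vanishes (λ x → p (root y x)) y≤i
  ... | inj₁ (x , refl) = trans (extend-toℕ (λ x → p (root y x)) x) p≡0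
    where
    p≡0 : p (root y x) ≡ 0
    p≡0 with p (root y x) ℕ.≟ 0
    ... | yes p≡0 = p≡0
    ... | no  p≢0 = contradiction (supp (root y x) p≢0) (ℕ.≤⇒≯ n≤i)

-- `rootsOf` reads only the entries with `i < j ≤ r`, and `coefficient` puts 0 everywhere else. The
-- round trip therefore restores exactly the matrices that vanish there.
coefficient-rootsOf : ∀ {c} → StrictlyUpper r c →
                      ∀ i j → coefficient (rootsOf {r} c) i j ≡ c i j
coefficient-rootsOf {r} {c} up i j with view-≤ (suc i) j | view-< (suc r) j
... | _ | inj₂ r<j = trans (StrictlyUpper.bounded (coefficient-strictlyUpper (rootsOf c)) i r<j)
                           (sym (StrictlyUpper.bounded up i r<j))
... | inj₂ j≤i | _ = trans (StrictlyUpper.triangular (coefficient-strictlyUpper (rootsOf {r} c)) (ℕ.≤-pred j≤i))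
                           (sym (StrictlyUpper.triangular up (ℕ.≤-pred j≤i)))
... | inj₁ (k , eq) | inj₁ (y , refl) with view-< (toℕ y) i
...   | inj₁ (x , refl) = coefficient-root (rootsOf c) (root y x)
...   | inj₂ y≤i = contradiction (subst (i <_) eq (s≤s (ℕ.m≤m+n i k))) (ℕ.≤⇒≯ y≤i)

-- The decision for a pair of indices computes to a conjunction of booleans. Fixing the target first
-- makes one conjunct constant, and each of the two sums then picks out a single term.
multiplicity≡coefficient : (p : Multiset r) → ∀ i j → multiplicity i j p ≡ coefficient p i j
multiplicity≡coefficient {r} p i j =
  trans (sumℕ-cong {suc r} column) (sumℕ-indicator (λ y → extend (λ x → p (root y x)) i) j)
  where
  column : ∀ y → sumℕ (λ x → if (toℕ x ≡ᵇ i) ∧ (toℕ y ≡ᵇ j) then p (root y x) else 0)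
               ≡ (if toℕ y ≡ᵇ j then extend (λ x → p (root y x)) i else 0)
  column y with toℕ y ≡ᵇ j
  ... | true  = trans (sumℕ-cong {toℕ y} λ x → cong (if_then p (root y x) else 0) (∧-identityʳ _))
                      (sumℕ-indicator (λ x → p (root y x)) i)
  ... | false = sumℕ-zero {toℕ y} _ λ x → cong (if_then p (root y x) else 0) (∧-zeroʳ _)

extend-sums : (p : Multiset r) → ∀ k →
              extend (λ y → sumℕ (λ x → p (root y x))) k ≡ inflow (coefficient p) k
extend-sums {r} p k with view-< (suc r) k
... | inj₁ (y , refl) = begin
  extend (λ y → sumℕ (λ x → p (root y x))) (toℕ y) ≡⟨ extend-toℕ (λ y → sumℕ (λ x → p (root y x))) y ⟩
  sumℕ (λ x → p (root y x))
    ≡⟨ sumℕ-cong {toℕ y} (λ x → coefficient-root p (root y x)) ⟨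
  inflow (coefficient p) (toℕ y)                   ∎
  where open ≡-Reasoning
... | inj₂ r<k = trans (extend-vanishes (λ y → sumℕ (λ x → p (root y x))) r<k)
  (sym (sumTo-zero k λ i → StrictlyUpper.bounded (coefficient-strictlyUpper p) i r<k))

landing≡inflow : (p : Multiset r) → ∀ j → landing j p ≡ inflow (coefficient p) j
landing≡inflow {r} p j = begin
  landing j p ≡⟨ sumℕ-cong {suc r} column ⟩
  sumℕ (λ y → if toℕ y ≡ᵇ j then sumℕ (λ x → p (root y x)) else 0)
    ≡⟨ sumℕ-indicator (λ y → sumℕ (λ x → p (root y x))) j ⟩
  extend (λ y → sumℕ (λ x → p (root y x))) j ≡⟨ extend-sums p j ⟩
  inflow (coefficient p) j ∎
  where
  open ≡-Reasoning
  column : ∀ y → sumℕ (λ x → if toℕ y ≡ᵇ j then p (root y x) else 0)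
               ≡ (if toℕ y ≡ᵇ j then sumℕ (λ x → p (root y x)) else 0)
  column y with toℕ y ≡ᵇ j
  ... | true  = refl
  ... | false = sumℕ-zero {toℕ y} _ λ _ → refl

-- Each copy of `ε_i - ε_j` adds 1 at coordinate `i` and takes 1 away at coordinate `j`. The roots
-- are grouped by target: the first part collects row `x`, the second survives only for target `x`.
total≡outflow-inflow : (p : Multiset r) (x : Fin (suc r)) →
  total p x ≡ + outflow r (coefficient p) (toℕ x) ℤ.- + inflow (coefficient p) (toℕ x)
total≡outflow-inflow {r} p z = begin
  total p z
    ≡⟨ sumℤ-cong {suc r} column ⟩
  sumℤ (λ y → + c k (toℕ y) ℤ.- + col y ℤ.* indicator (toℕ y) k)
    ≡⟨ sumℤ-minus {suc r} (λ y → + c k (toℕ y)) (λ y → + col y ℤ.* indicator (toℕ y) k) ⟩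
  sumℤ {suc r} (λ y → + c k (toℕ y)) ℤ.- sumℤ {suc r} (λ y → + col y ℤ.* indicator (toℕ y) k)
    ≡⟨ cong₂ ℤ._-_ (sumℤ-pos {suc r} (c k ∘ toℕ)) (sumℤ-indicator (+_ ∘ col) k) ⟩
  + outflow r c k ℤ.- padded (+_ ∘ col) k
    ≡⟨ cong (ℤ._-_ (+ outflow r c k)) (trans (padded-+ col k) (cong +_ (extend-sums p k))) ⟩
  + outflow r c k ℤ.- + inflow c k ∎
  where
  open ≡-Reasoning
  k = toℕ z
  c = coefficient p
  col : Fin (suc r) → ℕ
  col y = sumℕ (λ x → p (root y x))

  column : ∀ y → sumℤ (λ x → + p (root y x) ℤ.* (indicator (toℕ x) k ℤ.- indicator (toℕ y) k))
               ≡ + c k (toℕ y) ℤ.- + col y ℤ.* indicator (toℕ y) k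
  column y = begin
    sumℤ (λ x → q x ℤ.* (indicator (toℕ x) k ℤ.- e))
      ≡⟨ sumℤ-cong {toℕ y} (λ x → distrib (q x) (indicator (toℕ x) k) e) ⟩
    sumℤ (λ x → q x ℤ.* indicator (toℕ x) k ℤ.- q x ℤ.* e)
      ≡⟨ sumℤ-minus {toℕ y} _ _ ⟩
    sumℤ (λ x → q x ℤ.* indicator (toℕ x) k) ℤ.- sumℤ (λ x → q x ℤ.* e)
      ≡⟨ cong₂ ℤ._-_ (sumℤ-indicator q k) (sym (sumℤ-*ʳ {toℕ y} e q)) ⟩
    padded q k ℤ.- sumℤ q ℤ.* e
      ≡⟨ cong₂ (λ u v → u ℤ.- v ℤ.* e) (padded-+ (λ x → p (root y x)) k) (sumℤ-pos {toℕ y} _) ⟩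
    + extend (λ x → p (root y x)) k ℤ.- + col y ℤ.* e
      ≡⟨ cong (λ u → + u ℤ.- + col y ℤ.* e) (extend-toℕ (λ y → extend (λ x → p (root y x)) k) y) ⟨
    + c k (toℕ y) ℤ.- + col y ℤ.* e ∎
    where
    e = indicator (toℕ y) k
    q : Fin (toℕ y) → ℤ
    q x = + p (root y x)
    distrib : ∀ u v w → u ℤ.* (v ℤ.- w) ≡ u ℤ.* v ℤ.- u ℤ.* w
    distrib = solve 3 (λ u v w → u :* (v :- w) := u :* v :- u :* w) refl
      where open +-*-Solver

-- Juggling sequences as matrices

-- `flow S i j` counts the throws of S at time i that land at time j.
flow : ∀ {a b} → JugglingSequence a b n → ℕ → ℕ → ℕ
flow S i j = extend (λ τ → shift 0 (suc i) (JugglingSequence.throws S τ) j) i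

flow-throws : ∀ {a b} (S : JugglingSequence a b n) τ k →
              flow S (toℕ τ) (suc (toℕ τ) + k) ≡ JugglingSequence.throws S τ k
flow-throws S τ k =
  trans (extend-toℕ (λ τ′ → shift 0 (suc (toℕ τ)) (JugglingSequence.throws S τ′) (suc (toℕ τ) + k)) τ)
        (shift-+ 0 (suc (toℕ τ)) (JugglingSequence.throws S τ) k)

flow-triangular : ∀ {a b} (S : JugglingSequence a b n) → ∀ {i j} → j ≤ i → flow S i j ≡ 0
flow-triangular S {i} j≤i =
  extend-zero _ (λ τ → shift-vanishes 0 (JugglingSequence.throws S τ) (s≤s j≤i)) i

flow-late : ∀ {a b} (S : JugglingSequence a b n) → ∀ {i} → n ≤ i → ∀ j → flow S i j ≡ 0
flow-late S {i} n≤i j =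
  extend-vanishes (λ τ → shift 0 (suc i) (JugglingSequence.throws S τ) j) n≤i

-- Equality of juggling sequences compares states only. The throws are recovered from two
-- consecutive states by cancelling in `next`.
flow-cong : ∀ {a b} {S T : JugglingSequence a b n} → Setoid._≈_ (JS a b n) S T →
            ∀ i j → flow S i j ≡ flow T i j
flow-cong {S = S} {T} S≈T i j =
  extend-cong (λ τ → shift-cong 0 (suc i) (λ k → ℤ.+-injective (throws≡ τ k)) j) i
  where
  open JugglingSequence
  open ≡-Reasoning
  throws≡ : ∀ τ k → + throws S τ k ≡ + throws T τ k
  throws≡ τ k = ℤ-cancelˡ (entry (state S (inject₁ τ)) (suc k)) _ _ (begin
    entry (state S (inject₁ τ)) (suc k) ℤ.+ + throws S τ k ≡⟨ Step.next (step S τ) k ⟨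
    entry (state S (suc τ)) k                              ≡⟨ S≈T (suc τ) k ⟩
    entry (state T (suc τ)) k                              ≡⟨ Step.next (step T τ) k ⟩
    entry (state T (inject₁ τ)) (suc k) ℤ.+ + throws T τ k
      ≡⟨ cong (ℤ._+ + throws T τ k) (S≈T (inject₁ τ) (suc k)) ⟨
    entry (state S (inject₁ τ)) (suc k) ℤ.+ + throws T τ k ∎)

-- Position `k` after `i` steps stands for the absolute landing time `i + k`: the balls due then are
-- those present at the start and those thrown in the first `i` steps.
entryAfter : (ℕ → ℤ) → (ℕ → ℕ → ℕ) → ℕ → ℕ → ℤ
entryAfter f c i k = f (i + k) ℤ.+ + sumTo i (λ τ → c τ (i + k))

-- A step lowers every ball by one but leaves its absolute landing time unchanged, so the only new
-- contribution is the entry of row `i`.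
entryAfter-suc : ∀ f c i k →
  entryAfter f c (suc i) k ≡ entryAfter f c i (suc k) ℤ.+ + c i (suc i + k)
entryAfter-suc f c i k rewrite ℕ.+-suc i k = begin
  f (suc (i + k)) ℤ.+ + sumTo (suc i) g        ≡⟨ cong (λ u → f (suc (i + k)) ℤ.+ + u) (sumTo-last i g) ⟩
  f (suc (i + k)) ℤ.+ + (sumTo i g + g i)      ≡⟨ ℤ.+-assoc (f _) (+ sumTo i g) (+ g i) ⟨
  f (suc (i + k)) ℤ.+ + sumTo i g ℤ.+ + g i    ∎
  where
  open ≡-Reasoning
  g : ℕ → ℕ
  g τ = c τ (suc (i + k))

entry≡entryAfter : ∀ {a b} (S : JugglingSequence a b n) i k →
  entry (JugglingSequence.state S i) k ≡ entryAfter (entry a) (flow S) (toℕ i) k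
entry≡entryAfter {a = a} S = <-weakInduction _ base induct
  where
  open JugglingSequence S
  open ≡-Reasoning
  base : ∀ k → entry (state zero) k ≡ entry a k ℤ.+ 0ℤ
  base k = trans (start k) (sym (ℤ.+-identityʳ _))
  induct : ∀ τ → (∀ k → entry (state (inject₁ τ)) k ≡ entryAfter (entry a) (flow S) (toℕ (inject₁ τ)) k) →
           ∀ k → entry (state (suc τ)) k ≡ entryAfter (entry a) (flow S) (suc (toℕ τ)) k
  induct τ ih k = begin
    entry (state (suc τ)) k
      ≡⟨ Step.next (step τ) k ⟩
    entry (state (inject₁ τ)) (suc k) ℤ.+ + throws τ k
      ≡⟨ cong₂ (λ u v → u ℤ.+ + v) (ih (suc k)) (sym (flow-throws S τ k)) ⟩
    entryAfter (entry a) (flow S) (toℕ (inject₁ τ)) (suc k) ℤ.+ + flow S (toℕ τ) (suc (toℕ τ) + k)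
      ≡⟨ cong (λ i → entryAfter (entry a) (flow S) i (suc k) ℤ.+ + flow S (toℕ τ) (suc (toℕ τ) + k)) (Fin.toℕ-inject₁ τ) ⟩
    entryAfter (entry a) (flow S) (toℕ τ) (suc k) ℤ.+ + flow S (toℕ τ) (suc (toℕ τ) + k)
      ≡⟨ entryAfter-suc (entry a) (flow S) (toℕ τ) k ⟨
    entryAfter (entry a) (flow S) (suc (toℕ τ)) k ∎

-- Reconciles two truncations of a column: `inflow` stops at the diagonal, while the final state
-- counts the throws of the `n` steps.
sumTo-past : ∀ {c} → (∀ {i j} → j ≤ i → c i j ≡ 0) → (∀ {i} → n ≤ i → ∀ j → c i j ≡ 0) →
             ∀ {x} → n ≤ x → inflow c x ≡ sumTo n (λ i → c i x)
sumTo-past {n} {c} triangular late {x} n≤x =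
  sumTo-agree x n (λ i → c i x) (λ _ → triangular) (λ _ n≤i → late n≤i x)

-- Conservation of flow on the vertices 0, 1, 2 and so on, with net supply `μ x` at `x`. It is
-- imposed at every natural number, so indices beyond `r` are covered too.
Balanced : ℕ → (ℕ → ℕ → ℕ) → (ℕ → ℤ) → Set
Balanced r c μ = ∀ x → + outflow r c x ≡ μ x ℤ.+ + inflow c x

-- The vector δ with coordinates in all of ℕ, in a form that splits into the cases `x < n` and
-- `x = n + k`.
difference : Vector ℤ s → Vector ℤ t → ℕ → ℕ → ℤ
difference a b n x = padded a x ℤ.- shift 0ℤ n (padded b) x

difference-early : (a : Vector ℤ s) (b : Vector ℤ t) → ∀ {n x} → x < n →
                   difference a b n x ≡ padded a x
difference-early a b x<n =
  trans (cong (λ u → padded a _ ℤ.- u) (shift-vanishes 0ℤ (padded b) x<n)) (ℤ.+-identityʳ _)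

difference-late : (a : Vector ℤ s) (b : Vector ℤ t) → ∀ n k →
                  difference a b n (n + k) ≡ padded a (n + k) ℤ.- padded b k
difference-late a b n k = cong (λ u → padded a (n + k) ℤ.- u) (shift-+ 0ℤ n (padded b) k)

δ≡difference : (a : Vector ℤ s) (b : Vector ℤ t) → ∀ n (x : Fin (suc r)) →
               δ a b n x ≡ difference a b n (toℕ x)
δ≡difference a b n x =
  cong₂ ℤ._-_ (sumℤ-indicator a (toℕ x)) (sumℤ-indicator-shift b n (toℕ x))

-- The correspondence between juggling sequences and partitions of δ.

module Correspondence {s t} (a : Vector ℤ s) (b : Vector ℤ t) (n r : ℕ)
                      (dim : suc r ≡ s ⊔ (n + t)) where

  s≤1+r : s ≤ suc r
  s≤1+r = subst (s ≤_) (sym dim) (ℕ.m≤m⊔n s (n + t))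

  n+t≤1+r : n + t ≤ suc r
  n+t≤1+r = subst (n + t ≤_) (sym dim) (ℕ.m≤n⊔m s (n + t))

  a-vanishes : ∀ {x} → r < x → padded a x ≡ 0ℤ
  a-vanishes r<x = padded-vanishes a _ (ℕ.≤-trans s≤1+r r<x)

  b-vanishes : ∀ {k} → r < n + k → padded b k ≡ 0ℤ
  b-vanishes {k} r<n+k =
    padded-vanishes b k (ℕ.+-cancelˡ-≤ n t k (ℕ.≤-trans n+t≤1+r r<n+k))

  n≤1+r : n ≤ suc r
  n≤1+r = ℕ.≤-trans (ℕ.m≤m+n n t) n+t≤1+r

  difference-vanishes : ∀ {x} → r < x → difference a b n x ≡ 0ℤ
  difference-vanishes {x} r<x with view-≤ n x
  ... | inj₁ (k , refl) =
    trans (difference-late a b n k) (cong₂ ℤ._-_ (a-vanishes r<x) (b-vanishes r<x))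
  ... | inj₂ x<n = trans (difference-early a b x<n) (a-vanishes r<x)

  -- From juggling sequences to flows.

  module _ (S : JugglingSequence ⟨ a ⟩ ⟨ b ⟩ n) where

    open JugglingSequence S
    open ≡-Reasoning

    final : ∀ k → padded b k ≡ padded a (n + k) ℤ.+ + sumTo n (λ i → flow S i (n + k))
    final k = begin
      padded b k                                          ≡⟨ end k ⟨
      entry (state (fromℕ n)) k                           ≡⟨ entry≡entryAfter S (fromℕ n) k ⟩
      entryAfter (padded a) (flow S) (toℕ (fromℕ n)) k
        ≡⟨ cong (λ i → entryAfter (padded a) (flow S) i k) (Fin.toℕ-fromℕ n) ⟩
      entryAfter (padded a) (flow S) n k                  ∎

    -- At a position `n + k` beyond `r` both `a` and `b` are zero, so by `final` the throws landing
    -- there sum to 0. Throw counts are natural numbers, so each of them is 0.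
    flow-bounded : ∀ i {j} → r < j → flow S i j ≡ 0
    flow-bounded i {j} r<j with view-≤ n j | ℕ.<-≤-connex i n
    ... | _ | inj₂ n≤i = flow-late S n≤i j
    ... | inj₂ j<n | _ = contradiction (ℕ.<-≤-trans r<j (ℕ.≤-pred (ℕ.≤-trans j<n n≤1+r))) (ℕ.<-irrefl refl)
    ... | inj₁ (k , refl) | inj₁ i<n =
      ℕ.n≤0⇒n≡0 (subst (flow S i (n + k) ≤_) (sym (ℤ.+-injective nothing-lands)) (term≤sumTo (λ i → flow S i (n + k)) i<n))
      where
      nothing-lands : 0ℤ ≡ + sumTo n (λ i → flow S i (n + k))
      nothing-lands = begin
        0ℤ         ≡⟨ b-vanishes r<j ⟨
        padded b k ≡⟨ final k ⟩
        padded a (n + k) ℤ.+ + sumTo n (λ i → flow S i (n + k))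
          ≡⟨ cong (ℤ._+ + sumTo n (λ i → flow S i (n + k))) (a-vanishes r<j) ⟩
        0ℤ ℤ.+ + sumTo n (λ i → flow S i (n + k)) ≡⟨ ℤ.+-identityˡ _ ⟩
        + sumTo n (λ i → flow S i (n + k)) ∎

    flow-strictlyUpper : StrictlyUpper r (flow S)
    flow-strictlyUpper = record { triangular = flow-triangular S ; bounded = flow-bounded }

    -- `Step.total` sums over heights up to the bound stored in the step, `outflow` over landing
    -- times up to `r`. Both are sums of row `i`: the columns up to `i` are dropped, and beyond
    -- either bound the row is zero.
    outflow-throws : ∀ τ → + outflow r (flow S) (toℕ τ) ≡ entry (state (inject₁ τ)) 0
    outflow-throws τ = begin
      + sumTo (suc r) (flow S i)
        ≡⟨ cong +_ (sumTo-agree (suc r) (suc i + K) (flow S i) (λ _ → flow-bounded i) beyond) ⟩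
      + sumTo (suc i + K) (flow S i)
        ≡⟨ cong +_ (sumTo-drop (suc i) K (flow S i) λ k → flow-triangular S ∘ ℕ.≤-pred) ⟩
      + sumTo K (flow S i ∘ (_+_ (suc i)))
        ≡⟨ cong +_ (sumTo-cong K λ {k} _ → flow-throws S τ k) ⟩
      + sumTo K (throws τ)
        ≡⟨ Step.total (step τ) ⟩
      entry (state (inject₁ τ)) 0 ∎
      where
      i = toℕ τ
      K = FinitelySupported.bound (Step.finite (step τ))
      beyond : ∀ k → suc i + K ≤ k → flow S i k ≡ 0
      beyond k h with view-≤ (suc i) k
      ... | inj₁ (k′ , refl) = trans (flow-throws S τ k′)
        (FinitelySupported.vanishes (Step.finite (step τ)) k′ (ℕ.+-cancelˡ-≤ (suc i) K k′ h))
      ... | inj₂ k<1+i = flow-triangular S (ℕ.≤-pred k<1+i)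

    flow-balanced : Balanced r (flow S) (difference a b n)
    flow-balanced x with view-< n x
    ... | inj₁ (τ , refl) = begin
      + outflow r (flow S) i            ≡⟨ outflow-throws τ ⟩
      entry (state (inject₁ τ)) 0       ≡⟨ entry≡entryAfter S (inject₁ τ) 0 ⟩
      entryAfter (padded a) (flow S) (toℕ (inject₁ τ)) 0
        ≡⟨ cong (λ j → entryAfter (padded a) (flow S) j 0) (Fin.toℕ-inject₁ τ) ⟩
      entryAfter (padded a) (flow S) i 0
        ≡⟨ cong (λ j → padded a j ℤ.+ + sumTo i (λ τ → flow S τ j)) (ℕ.+-identityʳ i) ⟩
      padded a i ℤ.+ + inflow (flow S) i
        ≡⟨ cong (ℤ._+ + inflow (flow S) i) (difference-early a b (Fin.toℕ<n τ)) ⟨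
      difference a b n i ℤ.+ + inflow (flow S) i ∎
      where i = toℕ τ
    ... | inj₂ n≤x with view-≤ n x
    ...   | inj₂ x<n = contradiction x<n (ℕ.≤⇒≯ n≤x)
    -- Row `n + k` is empty, so the right side has to vanish. It is `a - b + u` with `u` the column
    -- sum, and `final` says that `b` equals `a + u`.
    ...   | inj₁ (k , refl) = begin
      + outflow r (flow S) (n + k)  ≡⟨ cong +_ (sumTo-zero (suc r) (flow-late S n≤x)) ⟩
      0ℤ                            ≡⟨ ℤ.+-inverseˡ (+ u) ⟨
      ℤ.- (+ u) ℤ.+ + u             ≡⟨ cong (ℤ._+ + u) (rearrange (padded a (n + k)) (+ u)) ⟩
      padded a (n + k) ℤ.- (padded a (n + k) ℤ.+ + u) ℤ.+ + u
        ≡⟨ cong (λ v → padded a (n + k) ℤ.- v ℤ.+ + u) (final k) ⟨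
      padded a (n + k) ℤ.- padded b k ℤ.+ + u
        ≡⟨ cong₂ (λ v w → v ℤ.+ + w) (difference-late a b n k) (sumTo-past (flow-triangular S) (flow-late S) n≤x) ⟨
      difference a b n (n + k) ℤ.+ + inflow (flow S) (n + k) ∎
      where
      u = sumTo n (λ i → flow S i (n + k))
      rearrange : ∀ v w → ℤ.- w ≡ v ℤ.- (v ℤ.+ w)
      rearrange = solve 2 (λ v w → :- w := v :- (v :+ w)) refl
        where open +-*-Solver

  -- The meeting point of the two sides: juggling sequences and partitions both yield such matrices,
  -- and every such matrix comes from one of each.
  record IsFlow (c : ℕ → ℕ → ℕ) : Set where
    field
      strictlyUpper : StrictlyUpper r c
      late          : ∀ {i} → n ≤ i → ∀ j → c i j ≡ 0
      balanced      : Balanced r c (difference a b n)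
    open StrictlyUpper strictlyUpper public

  flow-isFlow : ∀ S → IsFlow (flow S)
  flow-isFlow S = record
    { strictlyUpper = flow-strictlyUpper S
    ; late          = flow-late S
    ; balanced      = flow-balanced S
    }

  -- Partitions and flows.

  partition-isFlow : ∀ {p} → IsPartition Λ[ n ] (δ {r} a b n) p → IsFlow (coefficient p)
  partition-isFlow {p} partition = record
    { strictlyUpper = up
    ; late          = coefficient-unsupported p support
    ; balanced      = balanced
    }
    where
    open IsPartition partition
    open ≡-Reasoning
    up = coefficient-strictlyUpper p
    c = coefficient p
    recover : ∀ u v → u ≡ u ℤ.- v ℤ.+ v
    recover = solve 2 (λ u v → u := u :- v :+ v) refl
      where open +-*-Solver
    balanced : Balanced r c (difference a b n)
    balanced x with view-< (suc r) x
    ... | inj₁ (y , refl) = begin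
      + outflow r c (toℕ y)
        ≡⟨ recover _ (+ inflow c (toℕ y)) ⟩
      + outflow r c (toℕ y) ℤ.- + inflow c (toℕ y) ℤ.+ + inflow c (toℕ y)
        ≡⟨ cong (ℤ._+ + inflow c (toℕ y)) (total≡outflow-inflow p y) ⟨
      total p y ℤ.+ + inflow c (toℕ y)
        ≡⟨ cong (ℤ._+ + inflow c (toℕ y)) (trans (sums y) (δ≡difference a b n y)) ⟩
      difference a b n (toℕ y) ℤ.+ + inflow c (toℕ y) ∎
    -- Here `sums` gives no information, but every term is zero: row `x` has only columns up to `r`,
    -- which lie below the diagonal, and column `x` is beyond the dimension.
    ... | inj₂ r<x = begin
      + outflow r c x
        ≡⟨ cong +_ (sumTo-cong (suc r) λ k<1+r → StrictlyUpper.triangular up (ℕ.≤-trans (ℕ.<⇒≤ k<1+r) r<x)) ⟩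
      + sumTo (suc r) (λ _ → 0)
        ≡⟨ cong +_ (trans (sumTo-zero (suc r) (λ _ → refl)) (sym (sumTo-zero x λ i → StrictlyUpper.bounded up i r<x))) ⟩
      + inflow c x
        ≡⟨ ℤ.+-identityˡ _ ⟨
      0ℤ ℤ.+ + inflow c x
        ≡⟨ cong (ℤ._+ + inflow c x) (difference-vanishes r<x) ⟨
      difference a b n x ℤ.+ + inflow c x ∎

  flow-isPartition : ∀ {c} → IsFlow c → IsPartition Λ[ n ] (δ {r} a b n) (rootsOf c)
  flow-isPartition {c} isFlow = record
    { support = λ α c≢0 → ℕ.≰⇒> λ n≤i → c≢0 (late n≤i (tgt α))
    ; sums    = sums
    }
    where
    open IsFlow isFlow
    open ≡-Reasoning
    recover : ∀ u v → (u ℤ.+ v) ℤ.- v ≡ u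
    recover = solve 2 (λ u v → (u :+ v) :- v := u) refl
      where open +-*-Solver
    sums : ∀ x → total (rootsOf {r} c) x ≡ δ a b n x
    sums x = begin
      total p x
        ≡⟨ total≡outflow-inflow p x ⟩
      + outflow r (coefficient p) k ℤ.- + inflow (coefficient p) k
        ≡⟨ cong₂ (λ u v → + u ℤ.- + v) (sumTo-cong (suc r) λ {j} _ → coefficient-rootsOf strictlyUpper k j)
                                       (sumTo-cong k λ {i} _ → coefficient-rootsOf strictlyUpper i k) ⟩
      + outflow r c k ℤ.- + inflow c k
        ≡⟨ cong (ℤ._- + inflow c k) (balanced k) ⟩
      (difference a b n k ℤ.+ + inflow c k) ℤ.- + inflow c k
        ≡⟨ recover (difference a b n k) (+ inflow c k) ⟩
      difference a b n k
        ≡⟨ δ≡difference a b n x ⟨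
      δ a b n x ∎
      where
      k = toℕ x
      p = rootsOf {r} c

  -- From flows to juggling sequences.

  module _ {c} (isFlow : IsFlow c) where

    open IsFlow isFlow
    open ≡-Reasoning

    flowState : ℕ → State
    flowState i = record
      { entry  = entryAfter (padded a) c i
      ; finite = record
        { bound    = suc r
        ; vanishes = λ k r<k → cong₂ (λ u v → u ℤ.+ + v)
            (a-vanishes (ℕ.≤-trans r<k (ℕ.m≤n+m k i)))
            (sumTo-zero i λ τ → bounded τ (ℕ.≤-trans r<k (ℕ.m≤n+m k i)))
        }
      }

    flowStep : (τ : Fin n) → Step (flowState (toℕ (inject₁ τ))) (flowState (toℕ (suc τ)))
    flowStep τ = subst (λ i → Step (flowState i) (flowState (suc (toℕ τ)))) (sym (Fin.toℕ-inject₁ τ)) record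
      { throws = throws
      ; finite = record
        { bound    = suc r
        ; vanishes = λ k r<k → bounded i (ℕ.≤-trans r<k (ℕ.m≤n+m k (suc i)))
        }
      ; total  = begin
          + sumTo (suc r) throws
            -- The first `suc r` heights reach columns up to `suc i + r`. Those beyond `r` hold
            -- zeros, so the sum is still that of row `i`.
            ≡⟨ cong +_ (sumTo-drop (suc i) (suc r) (c i) λ k → triangular ∘ ℕ.≤-pred) ⟨
          + sumTo (suc i + suc r) (c i)
            ≡⟨ cong +_ (sumTo-agree (suc i + suc r) (suc r) (c i)
                  (λ k h → bounded i (ℕ.≤-trans (ℕ.m≤n+m (suc r) (suc i)) h)) (λ k → bounded i)) ⟩
          + outflow r c i
            ≡⟨ balanced i ⟩
          difference a b n i ℤ.+ + inflow c i
            ≡⟨ cong (ℤ._+ + inflow c i) (difference-early a b (Fin.toℕ<n τ)) ⟩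
          padded a i ℤ.+ + inflow c i
            ≡⟨ cong (λ j → padded a j ℤ.+ + sumTo i (λ τ → c τ j)) (ℕ.+-identityʳ i) ⟨
          entryAfter (padded a) c i 0 ∎
      ; next   = entryAfter-suc (padded a) c i
      }
      where
      i = toℕ τ
      throws : ℕ → ℕ
      throws k = c i (suc i + k)

    final-entry : ∀ k → entryAfter (padded a) c (toℕ (fromℕ n)) k ≡ padded b k
    final-entry k = begin
      entryAfter (padded a) c (toℕ (fromℕ n)) k
        ≡⟨ cong (λ i → entryAfter (padded a) c i k) (Fin.toℕ-fromℕ n) ⟩
      padded a (n + k) ℤ.+ + sumTo n (λ i → c i (n + k))
        ≡⟨ cong (λ u → padded a (n + k) ℤ.+ + u) (sumTo-past triangular late (ℕ.m≤m+n n k)) ⟨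
      padded a (n + k) ℤ.+ + inflow c (n + k)
        -- Splits off `padded b k` so that the remainder is the right side of `balanced` at `n + k`,
        -- which is the sum of the empty row `n + k`.
        ≡⟨ rearrange (padded a (n + k)) (padded b k) (+ inflow c (n + k)) ⟩
      padded b k ℤ.+ (padded a (n + k) ℤ.- padded b k ℤ.+ + inflow c (n + k))
        ≡⟨ cong (λ u → padded b k ℤ.+ (u ℤ.+ + inflow c (n + k))) (difference-late a b n k) ⟨
      padded b k ℤ.+ (difference a b n (n + k) ℤ.+ + inflow c (n + k))
        ≡⟨ cong (ℤ._+_ (padded b k)) (balanced (n + k)) ⟨
      padded b k ℤ.+ + outflow r c (n + k)
        ≡⟨ cong (λ u → padded b k ℤ.+ + u) (sumTo-zero (suc r) (late (ℕ.m≤m+n n k))) ⟩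
      padded b k ℤ.+ 0ℤ
        ≡⟨ ℤ.+-identityʳ (padded b k) ⟩
      padded b k ∎
      where
      rearrange : ∀ u v w → u ℤ.+ w ≡ v ℤ.+ (u ℤ.- v ℤ.+ w)
      rearrange = solve 3 (λ u v w → u :+ w := v :+ (u :- v :+ w)) refl
        where open +-*-Solver

    sequence : JugglingSequence ⟨ a ⟩ ⟨ b ⟩ n
    sequence = record
      { state = flowState ∘ toℕ
      ; start = λ k → ℤ.+-identityʳ _
      ; end   = final-entry
      ; step  = flowStep
      }

    -- The `subst` in `flowStep` only reindexes the source state; once its equation is `refl` it
    -- computes away.
    throws-sequence : ∀ τ k → JugglingSequence.throws sequence τ k ≡ c (toℕ τ) (suc (toℕ τ) + k)
    throws-sequence τ k rewrite Fin.toℕ-inject₁ τ = refl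

    flow-sequence : ∀ i j → flow sequence i j ≡ c i j
    flow-sequence i j with view-< n i | view-≤ (suc i) j
    ... | inj₂ n≤i | _ = trans (flow-late sequence n≤i j) (sym (late n≤i j))
    ... | inj₁ _ | inj₂ j≤i =
      trans (flow-triangular sequence (ℕ.≤-pred j≤i)) (sym (triangular (ℕ.≤-pred j≤i)))
    ... | inj₁ (τ , refl) | inj₁ (k , refl) = trans (flow-throws sequence τ k) (throws-sequence τ k)

  -- The closed form `entryAfter` determines all states from the matrix, and the matrix, being
  -- strictly upper triangular, is determined by its multiset of roots.
  rootsOf-flow-injective : ∀ S T → rootsOf {r} (flow S) ≗ rootsOf (flow T) →
                           Setoid._≈_ (JS ⟨ a ⟩ ⟨ b ⟩ n) S T
  rootsOf-flow-injective S T p≗q i k = begin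
    entry (state S i) k                            ≡⟨ entry≡entryAfter S i k ⟩
    entryAfter (padded a) (flow S) (toℕ i) k
      ≡⟨ cong (λ u → padded a (toℕ i + k) ℤ.+ + u)
              (sumTo-cong (toℕ i) {λ τ → flow S τ (toℕ i + k)} λ {τ} _ → flow≡ τ (toℕ i + k)) ⟩
    entryAfter (padded a) (flow T) (toℕ i) k       ≡⟨ entry≡entryAfter T i k ⟨
    entry (state T i) k                            ∎
    where
    open JugglingSequence
    open ≡-Reasoning
    flow≡ : ∀ i j → flow S i j ≡ flow T i j
    flow≡ i j = begin
      flow S i j                            ≡⟨ coefficient-rootsOf (flow-strictlyUpper S) i j ⟨
      coefficient (rootsOf {r} (flow S)) i j ≡⟨ coefficient-cong p≗q i j ⟩
      coefficient (rootsOf {r} (flow T)) i j ≡⟨ coefficient-rootsOf (flow-strictlyUpper T) i j ⟩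
      flow T i j                            ∎

  bijection : Bijection (JS ⟨ a ⟩ ⟨ b ⟩ n) (P {r} Λ[ n ] (δ a b n))
  bijection = record
    { to        = λ S → rootsOf (flow S) , flow-isPartition (flow-isFlow S)
    ; cong      = λ {S} {T} → congruent {S} {T}
    ; bijective = (λ {S} {T} → rootsOf-flow-injective S T) , surjective
    }
    where
    congruent : ∀ {S T} → Setoid._≈_ (JS ⟨ a ⟩ ⟨ b ⟩ n) S T → rootsOf {r} (flow S) ≗ rootsOf (flow T)
    congruent {S} {T} S≈T α = flow-cong {S = S} {T} S≈T (src α) (tgt α)
    surjective : ∀ q → ∃[ S ] (∀ {T} → Setoid._≈_ (JS ⟨ a ⟩ ⟨ b ⟩ n) T S → rootsOf (flow T) ≗ proj₁ q)
    surjective (p , partition) = S , λ {T} T≈S α →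
      trans (congruent {T} {S} T≈S α)
      (trans (flow-sequence (partition-isFlow partition) (src α) (tgt α)) (coefficient-root p α))
      where S = sequence (partition-isFlow partition)

  -- The equality of counts includes landing times beyond `r`, where `flow-bounded` makes both sides
  -- 0; hence no throw is lost in passing to roots.
  isRootsOfThrows : ∀ S → IsRootsOfThrows S (rootsOf {r} (flow S))
  isRootsOfThrows S = IsPartition.support (flow-isPartition (flow-isFlow S)) , λ τ k → begin
    multiplicity (toℕ τ) (toℕ τ + suc k) p ≡⟨ multiplicity≡coefficient p (toℕ τ) (toℕ τ + suc k) ⟩
    coefficient p (toℕ τ) (toℕ τ + suc k)
      ≡⟨ coefficient-rootsOf (flow-strictlyUpper S) (toℕ τ) (toℕ τ + suc k) ⟩
    flow S (toℕ τ) (toℕ τ + suc k)         ≡⟨ cong (flow S (toℕ τ)) (ℕ.+-suc (toℕ τ) k) ⟩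
    flow S (toℕ τ) (suc (toℕ τ) + k)       ≡⟨ flow-throws S τ k ⟩
    JugglingSequence.throws S τ k          ∎
    where
    open ≡-Reasoning
    p = rootsOf {r} (flow S)

  landing-rootsOf : ∀ S j → landing j (rootsOf {r} (flow S)) ≡ inflow (flow S) j
  landing-rootsOf S j = trans (landing≡inflow (rootsOf {r} (flow S)) j)
    (sumTo-cong j λ {i} _ → coefficient-rootsOf (flow-strictlyUpper S) i j)

  -- Hand capacity as a bound on landings.

  LandingAtMost : ℕ → Multiset r → Set
  LandingAtMost m p = ∀ j → padded a j ℤ.+ + landing j p ℤ.≤ + m

  handCapacity⇒landing : ∀ {m} S → HandCapacity m S → LandingAtMost m (rootsOf (flow S))
  handCapacity⇒landing {m} S capacity j rewrite landing-rootsOf S j with view-≤ n j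
  -- A position from `n` on is observed in the final state. An earlier one is observed at time `j`,
  -- as the lowest entry, when all throws landing there have been made.
  ... | inj₁ (k , refl) = subst (ℤ._≤ + m) eq (capacity (fromℕ n) k)
    where
    eq : entry (JugglingSequence.state S (fromℕ n)) k ≡ padded a (n + k) ℤ.+ + inflow (flow S) (n + k)
    eq = trans (trans (JugglingSequence.end S k) (final S k))
               (cong (λ u → padded a (n + k) ℤ.+ + u) (sym (sumTo-past (flow-triangular S) (flow-late S) (ℕ.m≤m+n n k))))
  ... | inj₂ j<n with view-< (suc n) j
  ...   | inj₂ n<j = contradiction (ℕ.<-trans j<n n<j) (ℕ.<-irrefl refl)
  ...   | inj₁ (i , refl) = subst (ℤ._≤ + m) eq (capacity i 0)
    where
    eq : entry (JugglingSequence.state S i) 0 ≡ padded a (toℕ i) ℤ.+ + inflow (flow S) (toℕ i)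
    eq = trans (entry≡entryAfter S i 0)
               (cong (λ j → padded a j ℤ.+ + sumTo (toℕ i) (λ τ → flow S τ j)) (ℕ.+-identityʳ (toℕ i)))

  -- The state at time `i` sees only the first `i` rows of column `i + k`; the later rows are
  -- nonnegative, so the full column sum bounds every entry.
  landing⇒handCapacity : ∀ {m} S → LandingAtMost m (rootsOf (flow S)) → HandCapacity m S
  landing⇒handCapacity {m} S capacity i k = begin
    entry (JugglingSequence.state S i) k
      ≡⟨ entry≡entryAfter S i k ⟩
    padded a j ℤ.+ + sumTo (toℕ i) (λ τ → flow S τ j)
      ≤⟨ ℤ.+-monoʳ-≤ (padded a j) (ℤ.+≤+ (sumTo-monoˡ (λ τ → flow S τ j) (ℕ.m≤m+n (toℕ i) k))) ⟩
    padded a j ℤ.+ + inflow (flow S) j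
      ≡⟨ cong (λ u → padded a j ℤ.+ + u) (landing-rootsOf S j) ⟨
    padded a j ℤ.+ + landing j (rootsOf {r} (flow S))
      ≤⟨ capacity j ⟩
    + m ∎
    where
    open ℤ.≤-Reasoning
    j = toℕ i + k

-- Restricting a bijection to subsets.

subsetoid : (X : Setoid 0ℓ 0ℓ) → Pred (Setoid.Carrier X) 0ℓ → Setoid 0ℓ 0ℓ
subsetoid X U = record
  { Carrier       = Σ (Setoid.Carrier X) U
  ; isEquivalence = On.isEquivalence proj₁ (Setoid.isEquivalence X)
  }

-- `JSₘ` and `Q` are definitionally subsetoids of `JS` and `P`, so the bijection with hand capacity
-- comes from the one without it.
restrict : ∀ {X Y : Setoid 0ℓ 0ℓ} {U V} (f : Bijection X Y) →
           (∀ x → U x → V (Bijection.to f x)) → (∀ x → V (Bijection.to f x) → U x) →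
           V Respects (Setoid._≈_ Y) → Bijection (subsetoid X U) (subsetoid Y V)
restrict {X} {Y} f U⇒V V⇒U resp = record
  { to        = λ (x , u) → to x , U⇒V x u
  ; cong      = cong′
  ; bijective = injective , λ (y , v) →
      let x , eq = surjective y
      -- The image of `x` is only equivalent to `y`, so `V` is carried from `y` to that image before
      -- it is pulled back.
      in (x , V⇒U x (resp (Setoid.sym Y (eq (Setoid.refl X))) v)) , eq
  }
  where open Bijection f renaming (cong to cong′)

-- Finiteness

Π-list : ∀ n {A : Fin n → Set} → (∀ i → List (A i)) → List (∀ i → A i)
Π-list zero    xs = [ (λ ()) ]
Π-list (suc n) xs = cartesianProductWith Fin.∀-cons (xs zero) (Π-list n (xs ∘ suc))

-- Completeness is relative to a pointwise relation, since a given function agrees with its listed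
-- copy only pointwise.
Π-list⁺ : ∀ n {A : Fin n → Set} {R : ∀ i → Pred (A i) 0ℓ} (xs : ∀ i → List (A i)) →
          (∀ i → Any (R i) (xs i)) → Any (λ f → ∀ i → R i (f i)) (Π-list n xs)
Π-list⁺ zero    xs xs-any = here λ ()
Π-list⁺ (suc n) xs xs-any =
  Any.cartesianProductWith⁺ Fin.∀-cons Fin.∀-cons
    (xs-any zero) (Π-list⁺ n (xs ∘ suc) (xs-any ∘ suc))

boundedMultisets : ∀ r → ℕ → List (Multiset r)
boundedMultisets r B =
  map (λ f α → f (Root.j α) (Root.i α))
      (Π-list (suc r) λ y → Π-list (toℕ y) λ _ → upTo (suc B))

∈-boundedMultisets : ∀ {B} (p : Multiset r) → (∀ α → p α ≤ B) → Any (p ≗_) (boundedMultisets r B)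
∈-boundedMultisets {r} p p≤B =
  Any.map⁺ (Any.map (λ f≡ α → f≡ (Root.j α) (Root.i α))
    (Π-list⁺ (suc r) _ λ y → Π-list⁺ (toℕ y) _ λ x → ∈-upTo⁺ (s≤s (p≤B (root y x)))))

allRoots? : {U : Pred (Root r) 0ℓ} → Decidable U → Dec (∀ α → U α)
allRoots? U? = map′ (λ h α → h (Root.j α) (Root.i α)) (λ h y x → h (root y x))
                    (Fin.all? λ y → Fin.all? λ x → U? (root y x))

multisets : ℕ → DecSetoid 0ℓ 0ℓ
multisets r = record
  { isDecEquivalence = record
    { isEquivalence = Setoid.isEquivalence (Root r →-setoid ℕ)
    ; _≟_           = λ p q → allRoots? λ α → p α ℕ.≟ q α
    }
  }

-- Counting the image of a map into a decidable setoid.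

module _ (DS : DecSetoid 0ℓ 0ℓ) where

  open DecSetoid DS using (Carrier; _≈_; _≟_) renaming (setoid to S)
  open Membership S using (_∈_)
  open Unique S using (Unique)
  private module S = Setoid S

  -- The converse of `index-injective`. It rests on uniqueness: in a list with repetitions, equal
  -- elements could be found at different positions.
  index-cong : ∀ {xs x y} → Unique xs → (x∈xs : x ∈ xs) (y∈xs : y ∈ xs) → x ≈ y →
               index x∈xs ≡ index y∈xs
  index-cong (_ ∷ _)  (here _)   (here _)   _   = refl
  index-cong (h ∷ _)  (here x≈)  (there y∈) x≈y =
    contradiction (Any.map (S.trans (S.trans (S.sym x≈) x≈y)) y∈) (All.All¬⇒¬Any h)
  index-cong (h ∷ _)  (there x∈) (here y≈)  x≈y =
    contradiction (Any.map (S.trans (S.trans (S.sym y≈) (S.sym x≈y))) x∈) (All.All¬⇒¬Any h)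
  index-cong (_ ∷ us) (there x∈) (there y∈) x≈y = cong suc (index-cong us x∈ y∈ x≈y)

  index-∈-lookup : ∀ xs i → index (∈-lookup S xs i) ≡ i
  index-∈-lookup (x ∷ xs) zero    = refl
  index-∈-lookup (x ∷ xs) (suc i) = cong suc (index-∈-lookup xs i)

  -- Elements of `B` will carry proofs, so their images are listed instead. As `U` describes the
  -- image exactly, filtering by it and removing duplicates leaves one position per equivalence
  -- class, and that position is the bijection.
  decidableImage-finite : ∀ {B : Set} {U : Pred Carrier 0ℓ} (f : B → Carrier) (xs : List Carrier) →
    Decidable U → U Respects _≈_ → (∀ x → f x ∈ xs) → (∀ x → U (f x)) →
    (∀ y → U y → ∃[ x ] f x ≡ y) → ∃[ N ] HasCardinality (On.setoid S f) N
  decidableImage-finite f xs U? resp complete sound image = length ys , record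
    { to        = position
    ; cong      = λ {x} {z} → index-cong ys! (listed x) (listed z)
    ; bijective = (λ {x} {z} → index-injective S (listed x) (listed z)) , surjective
    }
    where
    ys = deduplicate _≟_ (filter U? xs)
    ys! : Unique ys
    ys! = deduplicate-! DS (filter U? xs)
    listed : ∀ x → f x ∈ ys
    listed x = ∈-deduplicate⁺ S _≟_ (λ z≈y x≈y → S.trans x≈y (S.sym z≈y)) (∈-filter⁺ S U? resp (complete x) (sound x))
    position : _ → Fin (length ys)
    position x = index (listed x)
    surjective : ∀ i → ∃[ x ] (∀ {z} → f z ≈ f x → position z ≡ i)
    surjective i with image (lookup ys i) (All.lookup (All.deduplicate⁺ _≟_ (All.all-filter U? xs)) (lookup-∈ i))
    ... | x , eq = x , λ {z} z≈x →
      trans (index-cong ys! (listed z) (∈-lookup S ys i) (S.trans z≈x (S.reflexive eq))) (index-∈-lookup ys i)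

-- An a priori bound on multiplicities.

outflow-bound : (ℕ → ℤ) → ℕ → ℕ
outflow-bound μ zero    = 0
outflow-bound μ (suc x) = outflow-bound μ x + (ℤ.∣ μ x ∣ + outflow-bound μ x)

coefficient≤outflow : ∀ {c} → StrictlyUpper r c → ∀ i j → c i j ≤ outflow r c i
coefficient≤outflow {r} {c} up i j with ℕ.≤-<-connex j r
... | inj₁ j≤r = term≤sumTo (c i) (s≤s j≤r)
... | inj₂ r<j = subst (_≤ outflow r c i) (sym (StrictlyUpper.bounded up i r<j)) z≤n

-- The induction bounds the cumulative outflow of all vertices below `x`. Whatever enters `x` has
-- left an earlier vertex, so the outflow of `x` is at most `∣ μ x ∣` plus the previous bound; this
-- is the recursion of `outflow-bound`.
outflow-bounded : ∀ {c μ} → StrictlyUpper r c → Balanced r c μ →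
                  ∀ x → sumTo x (outflow r c) ≤ outflow-bound μ x
outflow-bounded             up balanced zero    = z≤n
outflow-bounded {r} {c} {μ} up balanced (suc x) = begin
  sumTo (suc x) (outflow r c)                  ≡⟨ sumTo-last x (outflow r c) ⟩
  sumTo x (outflow r c) + outflow r c x        ≤⟨ ℕ.+-mono-≤ ih step ⟩
  outflow-bound μ (suc x)                      ∎
  where
  open ℕ.≤-Reasoning
  ih = outflow-bounded up balanced x
  step : outflow r c x ≤ ℤ.∣ μ x ∣ + outflow-bound μ x
  step = begin
    outflow r c x                            ≡⟨ cong ℤ.∣_∣ (balanced x) ⟩
    ℤ.∣ μ x ℤ.+ + inflow c x ∣               ≤⟨ ℤ.∣i+j∣≤∣i∣+∣j∣ (μ x) (+ inflow c x) ⟩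
    ℤ.∣ μ x ∣ + inflow c x
      ≤⟨ ℕ.+-monoʳ-≤ ℤ.∣ μ x ∣ (sumTo-monoʳ x λ i → coefficient≤outflow up i x) ⟩
    ℤ.∣ μ x ∣ + sumTo x (outflow r c)        ≤⟨ ℕ.+-monoʳ-≤ ℤ.∣ μ x ∣ ih ⟩
    ℤ.∣ μ x ∣ + outflow-bound μ x            ∎

multiplicity-bounded : ∀ {μ} (p : Multiset r) → Balanced r (coefficient p) μ →
                       ∀ α → p α ≤ outflow-bound μ (suc r)
multiplicity-bounded {r} {μ} p balanced α@(root j i) = begin
  p α                                    ≡⟨ coefficient-root p α ⟨
  coefficient p (src α) (tgt α)          ≤⟨ coefficient≤outflow up (src α) (tgt α) ⟩
  outflow r (coefficient p) (src α)
    ≤⟨ term≤sumTo (outflow r (coefficient p)) (ℕ.<-trans (Fin.toℕ<n i) (Fin.toℕ<n j)) ⟩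
  sumTo (suc r) (outflow r (coefficient p)) ≤⟨ outflow-bounded up balanced (suc r) ⟩
  outflow-bound μ (suc r)                ∎
  where
  open ℕ.≤-Reasoning
  up = coefficient-strictlyUpper p

isPartition? : ∀ n (μ : Vector ℤ (suc r)) → Decidable (IsPartition Λ[ n ] μ)
isPartition? n μ p =
  map′ (λ (support , sums) → record { support = support ; sums = sums })
       (λ partition → IsPartition.support partition , IsPartition.sums partition)
       (allRoots? (λ α → ¬? (p α ℕ.≟ 0) →-dec (src α ℕ.<? n))
         ×-dec Fin.all? λ x → total p x ℤ.≟ μ x)

landing-cong : {p q : Multiset r} → p ≗ q → ∀ j → landing j p ≡ landing j q
landing-cong {p = p} {q} p≗q j = begin
  landing j p              ≡⟨ landing≡inflow p j ⟩
  inflow (coefficient p) j ≡⟨ sumTo-cong j (λ {i} _ → coefficient-cong p≗q i j) ⟩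
  inflow (coefficient q) j ≡⟨ landing≡inflow q j ⟨
  landing j q              ∎
  where open ≡-Reasoning

total-cong : {p q : Multiset r} → p ≗ q → total p ≗ total q
total-cong {r} {p} {q} p≗q x =
  sumℤ-cong {suc r} λ j → sumℤ-cong {toℕ j} λ i →
    cong (λ u → + u ℤ.* ⟦ root j i ⟧ x) (p≗q (root j i))

isPartition-respects : {Λ : Pred (Root r) 0ℓ} {μ : Vector ℤ (suc r)} → IsPartition Λ μ Respects _≗_
isPartition-respects p≗q partition = record
  { support = λ α q≢0 → support α λ p≡0 → q≢0 (trans (sym (p≗q α)) p≡0)
  ; sums    = λ x → trans (sym (total-cong p≗q x)) (sums x)
  }
  where open IsPartition partition

-- Finiteness of the sets of partitions.

module Finiteness {s t} (a : Vector ℤ s) (b : Vector ℤ t) (n r : ℕ)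
                  (dim : suc r ≡ s ⊔ (n + t)) where

  open Correspondence a b n r dim

  candidates : List (Multiset r)
  candidates = boundedMultisets r (outflow-bound (difference a b n) (suc r))

  ∈-candidates : ∀ {p} → IsPartition Λ[ n ] (δ a b n) p → Any (p ≗_) candidates
  ∈-candidates {p} partition =
    ∈-boundedMultisets p (multiplicity-bounded p (IsFlow.balanced (partition-isFlow partition)))

  -- Finitely many checks suffice: beyond `r` both `a` and the number of landings vanish, and the
  -- condition becomes `0 ≤ m`.
  landingAtMost? : ∀ m → Decidable (LandingAtMost m)
  landingAtMost? m p = map′ extended (λ h x → h (toℕ x))
    (Fin.all? λ (x : Fin (suc r)) → padded a (toℕ x) ℤ.+ + landing (toℕ x) p ℤ.≤? + m)
    where
    extended : (∀ (x : Fin (suc r)) → padded a (toℕ x) ℤ.+ + landing (toℕ x) p ℤ.≤ + m) → LandingAtMost m p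
    extended h j with view-< (suc r) j
    ... | inj₁ (x , refl) = h x
    ... | inj₂ r<j = subst (ℤ._≤ + m) (sym (cong₂ (λ u v → u ℤ.+ + v) (a-vanishes r<j) no-landing)) (ℤ.+≤+ z≤n)
      where
      no-landing : landing j p ≡ 0
      no-landing = trans (landing≡inflow p j)
        (sumTo-zero j λ i → StrictlyUpper.bounded (coefficient-strictlyUpper p) i r<j)

  landingAtMost-respects : ∀ {m} → LandingAtMost m Respects _≗_
  landingAtMost-respects p≗q h j =
    subst (λ u → padded a j ℤ.+ + u ℤ.≤ _) (landing-cong p≗q j) (h j)

  P-finite : ∃[ N ] HasCardinality (P {r} Λ[ n ] (δ a b n)) N
  P-finite = decidableImage-finite (multisets r) proj₁ candidates
    (isPartition? n (δ a b n)) isPartition-respects (∈-candidates ∘ proj₂) proj₂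
    (λ p partition → (p , partition) , refl)

  Q-finite : ∀ m → ∃[ N ] HasCardinality (Q {r} Λ[ n ] (δ a b n) a m) N
  Q-finite m = decidableImage-finite (multisets r) (proj₁ ∘ proj₁) candidates
    (λ p → isPartition? n (δ a b n) p ×-dec landingAtMost? m p)
    (λ p≗q (partition , h) → isPartition-respects p≗q partition , landingAtMost-respects p≗q h)
    (∈-candidates ∘ proj₂ ∘ proj₁)
    (λ ((p , partition) , h) → partition , h)
    (λ p (partition , h) → ((p , partition) , h) , refl)

mainTheorem7 : ∀ {s t : ℕ} (a : Vector ℤ s) (b : Vector ℤ t) → sumℤ a ≡ sumℤ b →
    (n m : ℕ) .{{_ : NonZero n}} .{{_ : NonZero m}} →
    (r : ℕ) → suc r ≡ s ⊔ (n + t) →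
    (Σ[ Ψ ∈ Bijection (JSₘ ⟨ a ⟩ ⟨ b ⟩ n m) (Q {r} Λ[ n ] (δ a b n) a m) ]
       (∀ S → IsRootsOfThrows (proj₁ S) (proj₁ (proj₁ (Bijection.to Ψ S)))))
    × (∃[ N ] HasCardinality (JSₘ ⟨ a ⟩ ⟨ b ⟩ n m) N
            × HasCardinality (Q {r} Λ[ n ] (δ a b n) a m) N)
    × (∃[ N ] HasCardinality (JS ⟨ a ⟩ ⟨ b ⟩ n) N
            × HasCardinality (P {r} Λ[ n ] (δ a b n)) N)
mainTheorem7 a b _ n m r dim =
    -- `restrict` keeps the underlying map, so the description of the multiset by throws carries
    -- over from `bijection` by computation.
    (Ψ , λ (S , _) → isRootsOfThrows S)
  , transport Ψ (Q-finite m)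
  , transport bijection P-finite
  where
  open Correspondence a b n r dim
  open Finiteness a b n r dim
  Ψ : Bijection (JSₘ ⟨ a ⟩ ⟨ b ⟩ n m) (Q {r} Λ[ n ] (δ a b n) a m)
  Ψ = restrict bijection handCapacity⇒landing landing⇒handCapacity landingAtMost-respects
  transport : ∀ {X Y} → Bijection X Y → ∃[ N ] HasCardinality Y N →
              ∃[ N ] HasCardinality X N × HasCardinality Y N
  transport f (N , g) = N , Composition.bijection f g , g
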